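{- Let $q$ be a prime power. A polynomial $f\in\mathbb{F}_q[x]$ is a shifting Costas polynomial if and only if $f(x)\equiv L(x^s)\pmod{x^q-x}$ for some linearized permutation polynomial $L(x)\in\mathbb{F}_q[x]$ and some positive integer $s$ with $\gcd(s,q-1)=1$.
   Context: Write $q=p^m$ with $p$ prime. A linearized permutation polynomial over $\mathbb{F}_q$ is a polynomial $L(x)=\sum_{j=0}^{m-1}c_jx^{p^j}\in\mathbb{F}_q[x]$ inducing a permutation of $\mathbb{F}_q$. A shifting Costas polynomial is a permutation polynomial $f\in\mathbb{F}_q[x]$ such that for every $d\in\mathbb{F}_q$ with $d\neq1$ there exists $a\in\mathbb{F}_q^*$ with $f(dx)-f(x)=f(ax)$ (as functions on $\mathbb{F}_q$, equivalently modulo $x^q-x$). -}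

module Defs where

open import Level using (Level; _⊔_; suc)
open import Data.Nat as ℕ using (ℕ)
open import Data.Fin using (Fin; toℕ)
open import Data.List using (List; []; _∷_)
open import Data.Product using (Σ; _×_; ∃; ∃-syntax; _,_)
open import Relation.Nullary using (¬_)
open import Algebra.Bundles using (CommutativeRing)
open import Function.Bundles using (Inverse)
import Relation.Binary.PropositionalEquality as P

record Field c ℓ : Set (Level.suc (c ⊔ ℓ)) where
  field
    commRing : CommutativeRing c ℓ
  open CommutativeRing commRing public
  field
    0≉1     : ¬ (0# ≈ 1#)
    inverse : ∀ x → ¬ (x ≈ 0#) → ∃[ y ] (x * y ≈ 1#)

module _ {c ℓ} (F : Field c ℓ) where
  open Field F

  HasCard : ℕ → Set (c ⊔ ℓ)
  HasCard q = Inverse (P.setoid (Fin q)) setoid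

  pow : Carrier → ℕ → Carrier
  pow x ℕ.zero    = 1#
  pow x (ℕ.suc n) = x * pow x n

  -- polynomials in F[x] as coefficient lists  a₀ ∷ a₁ ∷ … (constant term first);
  -- evaluation by Horner's rule
  Poly : Set c
  Poly = List Carrier

  eval : Poly → Carrier → Carrier
  eval []       x = 0#
  eval (a ∷ as) x = a + x * eval as x

  IsPermutation : (Carrier → Carrier) → Set (c ⊔ ℓ)
  IsPermutation g =
    (∀ x y → g x ≈ g y → x ≈ y) × (∀ y → ∃[ x ] (g x ≈ y))

  IsPermPoly : Poly → Set (c ⊔ ℓ)
  IsPermPoly f = IsPermutation (eval f)

  IsShiftingCostas : Poly → Set (c ⊔ ℓ)
  IsShiftingCostas f =
    IsPermPoly f ×
    (∀ d → ¬ (d ≈ 1#) →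
       ∃[ a ] (¬ (a ≈ 0#) × (∀ x → eval f (d * x) - eval f x ≈ eval f (a * x))))

  sumFin : (m : ℕ) → (Fin m → Carrier) → Carrier
  sumFin ℕ.zero    g = 0#
  sumFin (ℕ.suc m) g = g Fin.zero + sumFin m (λ j → g (Fin.suc j))
    where import Data.Fin as Fin

  linEval : (p m : ℕ) → (Fin m → Carrier) → Carrier → Carrier
  linEval p m cs x = sumFin m (λ j → cs j * pow x (p ℕ.^ toℕ j))

{-# OPTIONS --safe #-}
module Submission where

-- Reduce f modulo x^q − x to Σ_{i<q} cᵢ xⁱ. Comparing coefficients in f(dx) = f(x) + f(ax) gives dⁱ = 1 + aⁱ for every i
-- with cᵢ ≠ 0. Fix one such exponent s. Since a ≠ 0, dˢ = 1 only for d = 1, so s is prime to q − 1; let t invert s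
-- modulo q − 1. In terms of L(y) = f(yᵗ) the Costas condition says L(Du) = L(u) + L((D − 1)u), that is, L is additive.
-- Comparing coefficients once more, every exponent i of L satisfies (d + 1)ⁱ = dⁱ + 1 for all d, hence is a power of p.
-- Conversely, for f = L(xˢ) the element a with aˢ = dˢ − 1 works.

open import Defs
import Data.Nat as ℕ
open ℕ using (ℕ; zero; suc; z≤n; s≤s)
import Data.Nat.Properties as ℕ
open import Data.Nat.Combinatorics using (_C_; nCn≡1; nC1≡n; nCk≡nC[n∸k]; nCk≡n!/k![n-k]!; k![n∸k]!∣n!)
open import Data.Nat.Divisibility using (_∣_; divides; _∣?_; ∣⇒≤; ∣1⇒≡1; m∣m*n)
open import Data.Nat.DivMod using (m/n*n≡m)
open import Data.Nat.GCD using (gcd; gcd[m,n]∣m; gcd[m,n]∣n; module Bézout)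
open import Data.Nat.Coprimality using (Coprime; coprime-Bézout; gcd≡1⇒coprime)
open import Data.Nat.Primality using (Prime; prime⇒irreducible; euclidsLemma; prime⇒nonZero; prime⇒nonTrivial; ¬prime[0]; ¬prime[1])
open import Data.Nat.Induction using (<-rec)
open import Data.Fin as Fin using (Fin; zero; suc; toℕ; punchIn)
import Data.Fin.Properties as Fin
open import Data.Fin.Permutation using (Permutation′; permutation)
open import Data.List using (List; []; _∷_; _++_; length; replicate; applyUpTo)
import Data.List.Properties as List
open import Data.List.Relation.Unary.All using (All; []; _∷_)
open import Data.List.Relation.Unary.All.Properties using (applyUpTo⁻)
open import Data.Vec.Functional using (removeAt)
open import Data.Product using (_×_; ∃-syntax; _,_; proj₁; proj₂; map₂)
open import Data.Sum using (inj₁; inj₂)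
open import Function.Base using (_∘_; id; case_of_)
open import Function.Bundles using (Inverse; _⇔_; mk⇔)
open import Relation.Nullary using (¬_; Dec; yes; no; contradiction; ¬?)
open import Relation.Nullary.Decidable using (map′; decidable-stable)
open import Relation.Binary.PropositionalEquality as ≡ using (_≡_; cong; subst)
open import Algebra.Bundles using (CommutativeMonoid)
import Algebra.Properties.CommutativeMonoid.Sum as MonoidSum
import Algebra.Properties.CommutativeSemiring.Binomial as Binomial
import Algebra.Properties.CommutativeSemiring.Exp as Exp
import Algebra.Properties.Ring as RingProperties
import Algebra.Properties.Semiring.Mult as Mult
import Algebra.Properties.Semiring.Sum as Sum
import Algebra.Solver.Ring.NaturalCoefficients.Default as Solver
import Relation.Binary.Reasoning.Setoid as SetoidReasoning

-- Coefficients may be compared only below degree q: there q roots force a polynomial to be zero,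
-- whereas x^q - x vanishes everywhere without being zero. Hence both f and f(y^t) are first
-- rewritten with exponents below q. A single nonzero coefficient of f is enough. Its exponent s
-- pins down a through a^s = d^s - 1, which turns the bare existence of a into a formula; the other
-- coefficients of f are never examined one by one, since additivity of L already contains what they
-- must satisfy. The Costas condition is silent at d = 1, which corresponds to adding zero, so f(0)
-- = 0 has to be extracted separately. The same fact makes s positive. That p vanishes in the field
-- is likewise not given; it is deduced from the number of elements.

-- Divisibility of binomial coefficients by a prime.

prime∣!⇒≤ : ∀ {p} → Prime p → ∀ n → p ∣ n ℕ.! → p ℕ.≤ n
prime∣!⇒≤ {p} pr zero    p∣1 = contradiction (subst Prime (∣1⇒≡1 p∣1) pr) ¬prime[1]
prime∣!⇒≤ {p} pr (suc n) p∣  with euclidsLemma (suc n) (n ℕ.!) pr p∣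
... | inj₁ p∣1+n = ∣⇒≤ p∣1+n
... | inj₂ p∣n!  = ℕ.m≤n⇒m≤1+n (prime∣!⇒≤ pr n p∣n!)

-- In p! = (p C k) · k! · (p - k)! the prime p divides the left side but neither factorial on the
-- right, whose factors are all smaller than p.
prime∣nCk : ∀ {p k} → Prime p → 0 ℕ.< k → k ℕ.< p → p ∣ p C k
prime∣nCk {p@(suc p-1)} {k@(suc k-1)} pr 0<k k<p
  with euclidsLemma (p C k) (k ℕ.! ℕ.* (p ℕ.∸ k) ℕ.!) pr (subst (p ∣_) (≡.sym pCk*k![p-k]!≡p!) (m∣m*n (p-1 ℕ.!)))
  where
  instance _ = k ℕ.!* (p ℕ.∸ k) !≢0
  pCk*k![p-k]!≡p! : (p C k) ℕ.* (k ℕ.! ℕ.* (p ℕ.∸ k) ℕ.!) ≡ p ℕ.!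
  pCk*k![p-k]!≡p! = ≡.trans
    (cong (ℕ._* (k ℕ.! ℕ.* (p ℕ.∸ k) ℕ.!)) (nCk≡n!/k![n-k]! (ℕ.<⇒≤ k<p)))
    (m/n*n≡m (k![n∸k]!∣n! (ℕ.<⇒≤ k<p)))
... | inj₁ p∣pCk = p∣pCk
... | inj₂ p∣k![p-k]! with euclidsLemma (k ℕ.!) ((p ℕ.∸ k) ℕ.!) pr p∣k![p-k]!
...   | inj₁ p∣k!     = contradiction (prime∣!⇒≤ pr k p∣k!) (ℕ.<⇒≱ k<p)
...   | inj₂ p∣[p-k]! = contradiction (prime∣!⇒≤ pr (p ℕ.∸ k) p∣[p-k]!) (ℕ.<⇒≱ (s≤s (ℕ.m∸n≤m p-1 k-1)))

prime∤⇒coprime : ∀ {p n} → Prime p → ¬ (p ∣ n) → Coprime p n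
prime∤⇒coprime {p} pr p∤n (d∣p , d∣n) with prime⇒irreducible pr d∣p
... | inj₁ d≡1    = d≡1
... | inj₂ ≡.refl = contradiction d∣n p∤n

-- Reindexing a sum over a finite carrier.

module _ {a ℓ} (M : CommutativeMonoid a ℓ) where
  open CommutativeMonoid M
  open MonoidSum M

  -- Transported along the enumeration, `g` becomes a permutation of `Fin n`. A general commutative
  -- monoid allows two uses: the sum of all elements under translation by 1, and a product under
  -- multiplication by a nonzero element.
  sum-reindex : ∀ {n} (card : Inverse (≡.setoid (Fin n)) setoid) →
    ∀ {h} g g⁻¹ → (∀ {x y} → x ≈ y → h x ≈ h y) →
    (∀ {x y} → x ≈ y → g x ≈ g y) → (∀ {x y} → x ≈ y → g⁻¹ x ≈ g⁻¹ y) →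
    (∀ x → g (g⁻¹ x) ≈ x) → (∀ x → g⁻¹ (g x) ≈ x) →
    sum (h ∘ Inverse.to card) ≈ sum (h ∘ g ∘ Inverse.to card)
  sum-reindex {n} card {h} g g⁻¹ h-cong g-cong g⁻¹-cong gg⁻¹ g⁻¹g =
    trans (sum-permute (h ∘ to) π) (sum-cong-≋ {n} (λ i → h-cong (strictlyInverseˡ (g (to i)))))
    where
    open Inverse card
    from-to : ∀ u v → (∀ x → u (v x) ≈ x) → (∀ {x y} → x ≈ y → u x ≈ u y) →
      ∀ i → from (u (to (from (v (to i))))) ≡ i
    from-to u v uv u-cong i =
      ≡.trans (from-cong (trans (u-cong (strictlyInverseˡ (v (to i)))) (uv (to i)))) (strictlyInverseʳ i)
    π : Permutation′ n
    π = permutation (from ∘ g ∘ to) (from ∘ g⁻¹ ∘ to) (from-to g g⁻¹ gg⁻¹ g-cong) (from-to g⁻¹ g g⁻¹g g⁻¹-cong)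

-- Polynomials over an arbitrary field: roots, coefficient sequences, binomial expansion.

module FieldProperties {c ℓ} (F : Field c ℓ) where
  open Field F hiding (zero)
  open Exp commutativeSemiring public
  open Mult semiring public hiding (_×_)
  open Mult semiring public using () renaming (_×_ to _·_)
  open Sum semiring public
  open RingProperties ring public
  open Solver commutativeSemiring
  open SetoidReasoning setoid

  pow≡^ : ∀ x n → pow F x n ≡ x ^ n
  pow≡^ x zero    = ≡.refl
  pow≡^ x (suc n) = cong (x *_) (pow≡^ x n)

  xy≈0⇒y≈0 : ∀ {x y} → ¬ x ≈ 0# → x * y ≈ 0# → y ≈ 0#
  xy≈0⇒y≈0 {x} {y} x≉0 xy≈0 with z , xz≈1 ← inverse x x≉0 = begin
    y            ≈⟨ *-identityˡ y ⟨
    1# * y       ≈⟨ *-congʳ xz≈1 ⟨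
    x * z * y    ≈⟨ solve 3 (λ x y z → x :* z :* y := x :* y :* z) refl x y z ⟩
    x * y * z    ≈⟨ *-congʳ xy≈0 ⟩
    0# * z       ≈⟨ zeroˡ z ⟩
    0#           ∎

  *-cancelˡ-≉0 : ∀ {x y z} → ¬ x ≈ 0# → x * y ≈ x * z → y ≈ z
  *-cancelˡ-≉0 {x} {y} {z} x≉0 xy≈xz = x∙y⁻¹≈ε⇒x≈y y z (xy≈0⇒y≈0 x≉0 (begin
    x * (y - z)         ≈⟨ x[y-z]≈xy-xz x y z ⟩
    x * y - x * z       ≈⟨ +-congʳ xy≈xz ⟩
    x * z - x * z       ≈⟨ -‿inverseʳ (x * z) ⟩
    0#                  ∎))

  ^≉0 : ∀ {x} → ¬ x ≈ 0# → ∀ n → ¬ x ^ n ≈ 0#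
  ^≉0 x≉0 zero    1≈0 = 0≉1 (sym 1≈0)
  ^≉0 x≉0 (suc n) x^1+n≈0 = ^≉0 x≉0 n (xy≈0⇒y≈0 x≉0 x^1+n≈0)

  ^-^-comm : ∀ x m n → (x ^ m) ^ n ≈ (x ^ n) ^ m
  ^-^-comm x m n = begin
    (x ^ m) ^ n       ≈⟨ ^-assocʳ x m n ⟩
    x ^ (m ℕ.* n)     ≡⟨ cong (x ^_) (ℕ.*-comm m n) ⟩
    x ^ (n ℕ.* m)     ≈⟨ ^-assocʳ x n m ⟨
    (x ^ n) ^ m       ∎

  1^n≈1 : ∀ n → 1# ^ n ≈ 1#
  1^n≈1 zero    = refl
  1^n≈1 (suc n) = trans (*-identityˡ _) (1^n≈1 n)

  0^n≈0 : ∀ {n} → 0 ℕ.< n → 0# ^ n ≈ 0#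
  0^n≈0 {suc n} _ = zeroˡ _

  -- Synthetic division: the quotient of a + x·as(x) by x − r does not involve a.
  quotient : Carrier → List Carrier → List Carrier
  quotient r []       = []
  quotient r (a ∷ as) = eval F (a ∷ as) r ∷ quotient r as

  length-quotient : ∀ r as → length (quotient r as) ≡ length as
  length-quotient r []       = ≡.refl
  length-quotient r (a ∷ as) = cong suc (length-quotient r as)

  eval-quotient : ∀ r as x →
    x * eval F as x ≈ r * eval F as r + (x - r) * eval F (quotient r as) x
  eval-quotient r []       x = begin
    x * 0#                ≈⟨ zeroʳ x ⟩
    0#                    ≈⟨ +-identityˡ 0# ⟨
    0# + 0#               ≈⟨ +-cong (zeroʳ r) (zeroʳ (x - r)) ⟨
    r * 0# + (x - r) * 0# ∎
  eval-quotient r (a ∷ as) x = begin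
    x * (a + x * eval F as x)
      ≈⟨ *-congˡ (+-congˡ (eval-quotient r as x)) ⟩
    x * (a + (r * eval F as r + (x - r) * Q))
      ≈⟨ solve 5 (λ x a B D Q → x :* (a :+ (B :+ D :* Q)) := x :* (a :+ B) :+ D :* (x :* Q)) refl x a (r * eval F as r) (x - r) Q ⟩
    x * eval F (a ∷ as) r + (x - r) * (x * Q)
      -- The solver knows no subtraction, so x - r stays an atom and one factor x is split as r + (x
      -- - r).
      ≈⟨ +-congʳ (*-congʳ (sym r+[x-r]≈x)) ⟩
    (r + (x - r)) * eval F (a ∷ as) r + (x - r) * (x * Q)
      ≈⟨ solve 5 (λ r A D x Q → (r :+ D) :* A :+ D :* (x :* Q) := r :* A :+ D :* (A :+ x :* Q)) refl r (eval F (a ∷ as) r) (x - r) x Q ⟩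
    r * eval F (a ∷ as) r + (x - r) * (eval F (a ∷ as) r + x * Q) ∎
    where
    Q = eval F (quotient r as) x
    r+[x-r]≈x : r + (x - r) ≈ x
    r+[x-r]≈x = trans (+-comm r (x - r)) (trans (+-assoc x (- r) r) (trans (+-congˡ (-‿inverseˡ r)) (+-identityʳ x)))

  eval≈0 : ∀ {as} → All (_≈ 0#) as → ∀ x → eval F as x ≈ 0#
  eval≈0 []       x = refl
  eval≈0 (z ∷ zs) x = trans (+-cong z (trans (*-congˡ (eval≈0 zs x)) (zeroʳ x))) (+-identityʳ 0#)

  constant≈0 : ∀ {a as} x → All (_≈ 0#) as → eval F (a ∷ as) x ≈ 0# → a ≈ 0#
  constant≈0 {a} {as} x as≈0 root = begin
    a                   ≈⟨ +-identityʳ a ⟨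
    a + 0#              ≈⟨ +-congˡ (trans (*-congˡ (eval≈0 as≈0 x)) (zeroʳ x)) ⟨
    a + x * eval F as x ≈⟨ root ⟩
    0#                  ∎

  -- The entries of the quotient are the values at r of the suffixes of `as`; when all vanish, the
  -- coefficients vanish one after another, beginning with the last.
  quotient≈0⇒≈0 : ∀ r as → All (_≈ 0#) (quotient r as) → All (_≈ 0#) as
  quotient≈0⇒≈0 r []       []             = []
  quotient≈0⇒≈0 r (a ∷ as) (as[r]≈0 ∷ qs) = constant≈0 r as≈0 as[r]≈0 ∷ as≈0
    where as≈0 = quotient≈0⇒≈0 r as qs

  -- Dividing by x minus the first point leaves a quotient one coefficient shorter that still
  -- vanishes at the other points, because they differ from the first. Length at most n means degree
  -- below n.
  vanishing⇒≈0 : ∀ n (xs : Fin n → Carrier) → (∀ {i j} → xs i ≈ xs j → i ≡ j) →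
    ∀ as → length as ℕ.≤ n → (∀ i → eval F as (xs i) ≈ 0#) → All (_≈ 0#) as
  vanishing⇒≈0 n       xs inj []       _            roots = []
  vanishing⇒≈0 (suc n) xs inj (a ∷ as) (s≤s len≤n) roots = constant≈0 r as≈0 (roots zero) ∷ as≈0
    where
    r = xs zero
    xs-r≉0 : ∀ i → ¬ xs (suc i) - r ≈ 0#
    xs-r≉0 i eq = case inj (x∙y⁻¹≈ε⇒x≈y _ _ eq) of λ ()
    Q-roots : ∀ i → eval F (quotient r as) (xs (suc i)) ≈ 0#
    Q-roots i = xy≈0⇒y≈0 (xs-r≉0 i) (begin
      D                                      ≈⟨ +-identityˡ D ⟨
      0# + D                                 ≈⟨ +-congʳ (roots zero) ⟨
      a + r * eval F as r + D                ≈⟨ +-assoc a _ D ⟩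
      a + (r * eval F as r + D)              ≈⟨ +-congˡ (eval-quotient r as (xs (suc i))) ⟨
      a + xs (suc i) * eval F as (xs (suc i)) ≈⟨ roots (suc i) ⟩
      0#                                     ∎)
      where D = (xs (suc i) - r) * eval F (quotient r as) (xs (suc i))
    as≈0 = quotient≈0⇒≈0 r as (vanishing⇒≈0 n (xs ∘ suc) (Fin.suc-injective ∘ inj) (quotient r as)
             (subst (ℕ._≤ n) (≡.sym (length-quotient r as)) len≤n) Q-roots)

  -- The summand lives on all of ℕ and only the bound varies, so sums can be split and shifted
  -- without conversions between `Fin` types.
  ∑< : ℕ → (ℕ → Carrier) → Carrier
  ∑< n h = ∑[ i < n ] h (toℕ i)

  ∑<-cong : ∀ n {h k} → (∀ i → i ℕ.< n → h i ≈ k i) → ∑< n h ≈ ∑< n k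
  ∑<-cong n h≈k = sum-cong-≋ (λ i → h≈k (toℕ i) (Fin.toℕ<n i))

  ∑<-zero : ∀ n {h} → (∀ i → i ℕ.< n → h i ≈ 0#) → ∑< n h ≈ 0#
  ∑<-zero n h≈0 = trans (∑<-cong n h≈0) (sum-replicate-zero n)

  ∑<-+ : ∀ m n h → ∑< (m ℕ.+ n) h ≈ ∑< m h + ∑< n (h ∘ (m ℕ.+_))
  ∑<-+ zero    n h = sym (+-identityˡ _)
  ∑<-+ (suc m) n h = trans (+-congˡ (∑<-+ m n (h ∘ suc))) (sym (+-assoc _ _ _))

  ∑<-suc : ∀ n h → ∑< (suc n) h ≈ ∑< n h + h n
  ∑<-suc n h = begin
    ∑< (suc n) h                        ≡⟨ cong (λ k → ∑< k h) (ℕ.+-comm 1 n) ⟩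
    ∑< (n ℕ.+ 1) h                      ≈⟨ ∑<-+ n 1 h ⟩
    ∑< n h + (h (n ℕ.+ 0) + 0#)         ≈⟨ +-congˡ (+-identityʳ _) ⟩
    ∑< n h + h (n ℕ.+ 0)                ≡⟨ cong (λ k → ∑< n h + h k) (ℕ.+-identityʳ n) ⟩
    ∑< n h + h n                        ∎

  evalSeq : ℕ → (ℕ → Carrier) → Carrier → Carrier
  evalSeq n c x = ∑< n (λ i → c i * x ^ i)

  evalSeq-suc : ∀ n c x → evalSeq (suc n) c x ≈ c 0 + x * evalSeq n (c ∘ suc) x
  evalSeq-suc n c x = +-cong (*-identityʳ (c 0)) (begin
    ∑< n (λ i → c (suc i) * (x * x ^ i)) ≈⟨ ∑<-cong n (λ i _ → solve 3 (λ a x y → a :* (x :* y) := x :* (a :* y)) refl (c (suc i)) x (x ^ i)) ⟩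
    ∑< n (λ i → x * (c (suc i) * x ^ i)) ≈⟨ *-distribˡ-sum {n} x (λ i → c (suc (toℕ i)) * x ^ toℕ i) ⟨
    x * evalSeq n (c ∘ suc) x            ∎)

  evalSeq-0 : ∀ n c → evalSeq (suc n) c 0# ≈ c 0
  evalSeq-0 n c = trans (evalSeq-suc n c 0#) (trans (+-congˡ (zeroˡ _)) (+-identityʳ _))

  evalSeq-distrib-+ : ∀ n c e x → evalSeq n (λ i → c i + e i) x ≈ evalSeq n c x + evalSeq n e x
  evalSeq-distrib-+ n c e x = trans
    (∑<-cong n (λ i _ → distribʳ (x ^ i) (c i) (e i)))
    (∑-distrib-+ {n} (λ i → c (toℕ i) * x ^ toℕ i) (λ i → e (toℕ i) * x ^ toℕ i))

  evalSeq-scale : ∀ n c d x → evalSeq n (λ i → c i * d ^ i) x ≈ evalSeq n c (d * x)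
  evalSeq-scale n c d x = ∑<-cong n (λ i _ →
    trans (*-assoc (c i) (d ^ i) (x ^ i)) (*-congˡ (sym (^-distrib-* d x i))))

  eval-applyUpTo : ∀ n c x → eval F (applyUpTo c n) x ≈ evalSeq n c x
  eval-applyUpTo zero    c x = refl
  eval-applyUpTo (suc n) c x = trans (+-congˡ (*-congˡ (eval-applyUpTo n (c ∘ suc) x))) (sym (evalSeq-suc n c x))

  -- Both extreme terms are set apart because the uses concern the middle only: it vanishes for a
  -- prime exponent p when p is zero in the field, and for y = 1 it is the polynomial (x + 1)^n -
  -- x^n - 1.
  binomial-middle : ∀ k x y → (x + y) ^ (2 ℕ.+ k) ≈
    y ^ (2 ℕ.+ k) + (∑< (1 ℕ.+ k) (λ j → ((2 ℕ.+ k) C (1 ℕ.+ j)) · (x ^ (1 ℕ.+ j) * y ^ (1 ℕ.+ k ℕ.∸ j))) + x ^ (2 ℕ.+ k))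
  binomial-middle k x y = begin
    (x + y) ^ n                           ≈⟨ Binomial.theorem commutativeSemiring n x y ⟩
    ∑< (suc n) term                       ≈⟨ +-cong first (∑<-suc (suc k) (term ∘ suc)) ⟩
    y ^ n + (∑< (suc k) (term ∘ suc) + term n) ≈⟨ +-congˡ (+-congˡ last) ⟩
    y ^ n + (∑< (suc k) (term ∘ suc) + x ^ n)  ∎
    where
    n = 2 ℕ.+ k
    term : ℕ → Carrier
    term j = (n C j) · (x ^ j * y ^ (n ℕ.∸ j))
    first : term 0 ≈ y ^ n
    first = begin
      term 0              ≡⟨ cong (_· (1# * y ^ n)) (≡.trans (nCk≡nC[n∸k] {0} {n} z≤n) (nCn≡1 n)) ⟩
      1 · (1# * y ^ n)    ≈⟨ ×-homo-1 _ ⟩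
      1# * y ^ n          ≈⟨ *-identityˡ _ ⟩
      y ^ n               ∎
    last : term n ≈ x ^ n
    last = begin
      term n              ≡⟨ ≡.cong₂ (λ a b → a · (x ^ n * y ^ b)) (nCn≡1 n) (ℕ.n∸n≡0 n) ⟩
      1 · (x ^ n * 1#)    ≈⟨ ×-homo-1 _ ⟩
      x ^ n * 1#          ≈⟨ *-identityʳ _ ⟩
      x ^ n               ∎

  ·1≈0⇒·≈0 : ∀ {n} → n · 1# ≈ 0# → ∀ x → n · x ≈ 0#
  ·1≈0⇒·≈0 {n} n·1≈0 x = begin
    n · x          ≈⟨ ×-congʳ n (*-identityˡ x) ⟨
    n · (1# * x)   ≈⟨ ×-assoc-* n 1# x ⟨
    (n · 1#) * x   ≈⟨ *-congʳ n·1≈0 ⟩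
    0# * x         ≈⟨ zeroˡ x ⟩
    0#             ∎

  ∣⇒·≈0 : ∀ {p n} → p · 1# ≈ 0# → p ∣ n → ∀ x → n · x ≈ 0#
  ∣⇒·≈0 {p} {n} p·1≈0 (divides k n≡kp) x = begin
    n · x            ≡⟨ cong (_· x) (≡.trans n≡kp (ℕ.*-comm k p)) ⟩
    (p ℕ.* k) · x    ≈⟨ ×-assocˡ x p k ⟨
    p · (k · x)      ≈⟨ ·1≈0⇒·≈0 {p} p·1≈0 (k · x) ⟩
    0#               ∎

  -- A Bézout identity between p and n would yield 1 = 0. Over ℕ it comes in two forms, according to
  -- the side that carries the 1.
  coprime⇒·1≉0 : ∀ {p n} → Coprime p n → p · 1# ≈ 0# → ¬ n · 1# ≈ 0#
  coprime⇒·1≉0 {p} {n} cop p·1≈0 n·1≈0 = 0≉1 (sym (contra (coprime-Bézout cop)))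
    where
    multiple : ∀ m k → m · 1# ≈ 0# → (k ℕ.* m) · 1# ≈ 0#
    multiple m k m·1≈0 = ∣⇒·≈0 {m} m·1≈0 (divides k ≡.refl) 1#
    1+ : ∀ {m k} → m · 1# ≈ 0# → k · 1# ≈ 0# → 1 ℕ.+ m ≡ k → 1# ≈ 0#
    1+ {m} {k} m≈0 k≈0 eq = begin
      1#              ≈⟨ +-identityʳ 1# ⟨
      1# + 0#         ≈⟨ +-congˡ m≈0 ⟨
      (1 ℕ.+ m) · 1#  ≡⟨ cong (_· 1#) eq ⟩
      k · 1#          ≈⟨ k≈0 ⟩
      0#              ∎
    contra : Bézout.Identity 1 p n → 1# ≈ 0#
    contra (Bézout.+- x y eq) = 1+ (multiple n y n·1≈0) (multiple p x p·1≈0) eq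
    contra (Bézout.-+ x y eq) = 1+ (multiple p x p·1≈0) (multiple n y n·1≈0) eq

  sumFin≈sum : ∀ n {g h} → (∀ i → g i ≈ h i) → sumFin F n g ≈ sum h
  sumFin≈sum zero    g≈h = refl
  sumFin≈sum (suc n) g≈h = +-cong (g≈h zero) (sumFin≈sum n (g≈h ∘ suc))

  linEval≈ : ∀ p m cs x → linEval F p m cs x ≈ ∑[ j < m ] (cs j * x ^ (p ℕ.^ toℕ j))
  linEval≈ p m cs x = sumFin≈sum m (λ j → *-congˡ (reflexive (pow≡^ x (p ℕ.^ toℕ j))))

  linEval-cong : ∀ p m cs {x y} → x ≈ y → linEval F p m cs x ≈ linEval F p m cs y
  linEval-cong p m cs {x} {y} x≈y = begin
    linEval F p m cs x                         ≈⟨ linEval≈ p m cs x ⟩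
    ∑[ j < m ] (cs j * x ^ (p ℕ.^ toℕ j))      ≈⟨ sum-cong-≋ {m} (λ j → *-congˡ (^-congˡ (p ℕ.^ toℕ j) x≈y)) ⟩
    ∑[ j < m ] (cs j * y ^ (p ℕ.^ toℕ j))      ≈⟨ linEval≈ p m cs y ⟨
    linEval F p m cs y                         ∎

  eval-cong : ∀ f {x y} → x ≈ y → eval F f x ≈ eval F f y
  eval-cong []       x≈y = refl
  eval-cong (a ∷ as) x≈y = +-congˡ (*-cong x≈y (eval-cong as x≈y))

  Additive : (Carrier → Carrier) → Set _
  Additive g = ∀ x y → g (x + y) ≈ g x + g y

  -- Additivity of the Frobenius map and its iterates.

  module Frobenius {p} (pr : Prime p) (p·1≈0 : p · 1# ≈ 0#) where

    frobenius-additive : Additive (_^ p)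
    frobenius-additive = expand pr p·1≈0
      where
      expand : ∀ {p} → Prime p → p · 1# ≈ 0# → Additive (_^ p)
      expand {0}           pr = contradiction pr ¬prime[0]
      expand {1}           pr = contradiction pr ¬prime[1]
      expand {suc (suc k)} pr p·1≈0 x y = begin
        (x + y) ^ (2 ℕ.+ k)                   ≈⟨ binomial-middle k x y ⟩
        y ^ (2 ℕ.+ k) + (_ + x ^ (2 ℕ.+ k))   ≈⟨ +-congˡ (+-congʳ (∑<-zero (suc k) (λ j j<1+k →
                                                   ∣⇒·≈0 p·1≈0 (prime∣nCk pr (s≤s z≤n) (s≤s j<1+k)) (x ^ (1 ℕ.+ j) * y ^ (1 ℕ.+ k ℕ.∸ j))))) ⟩
        y ^ (2 ℕ.+ k) + (0# + x ^ (2 ℕ.+ k))  ≈⟨ +-congˡ (+-identityˡ _) ⟩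
        y ^ (2 ℕ.+ k) + x ^ (2 ℕ.+ k)         ≈⟨ +-comm _ _ ⟩
        x ^ (2 ℕ.+ k) + y ^ (2 ℕ.+ k)         ∎

    frobenius^-additive : ∀ k → Additive (_^ (p ℕ.^ k))
    frobenius^-additive zero    x y = distribʳ 1# x y
    frobenius^-additive (suc k) x y = begin
      (x + y) ^ (p ℕ.* p ℕ.^ k)                         ≈⟨ ^-assocʳ (x + y) p (p ℕ.^ k) ⟨
      ((x + y) ^ p) ^ (p ℕ.^ k)                         ≈⟨ ^-congˡ (p ℕ.^ k) (frobenius-additive x y) ⟩
      (x ^ p + y ^ p) ^ (p ℕ.^ k)                       ≈⟨ frobenius^-additive k (x ^ p) (y ^ p) ⟩
      (x ^ p) ^ (p ℕ.^ k) + (y ^ p) ^ (p ℕ.^ k)         ≈⟨ +-cong (^-assocʳ x p (p ℕ.^ k)) (^-assocʳ y p (p ℕ.^ k)) ⟩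
      x ^ (p ℕ.* p ℕ.^ k) + y ^ (p ℕ.* p ℕ.^ k)         ∎

-- Finite fields: decidable equality and Fermat's little theorem.

module FiniteField {c ℓ} (F : Field c ℓ) (r : ℕ) (card : HasCard F (2 ℕ.+ r)) where
  open Field F hiding (zero)
  open FieldProperties F
  open Inverse card hiding (inverse)
  open Solver commutativeSemiring
  open SetoidReasoning setoid

  -- Writing the size as 2 + r makes q - 1 equal to 1 + r without truncated subtraction.
  q : ℕ
  q = 2 ℕ.+ r

  infix 4 _≟_
  -- Decidability comes from indices in `Fin q`; later arguments by contradiction and case splits on
  -- zero rest on it.
  _≟_ : ∀ x y → Dec (x ≈ y)
  x ≟ y = map′ from-injective from-cong (from x Fin.≟ from y)
    where
    from-injective : from x ≡ from y → x ≈ y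
    from-injective eq = trans (sym (strictlyInverseˡ x)) (trans (to-cong eq) (strictlyInverseˡ y))

  to-injective : ∀ {i j} → to i ≈ to j → i ≡ j
  to-injective {i} {j} eq = ≡.trans (≡.sym (strictlyInverseʳ i)) (≡.trans (from-cong eq) (strictlyInverseʳ j))

  -- Translation by 1 permutes the field, so the sum S of all elements satisfies S = q·1 + S.
  q·1≈0 : q · 1# ≈ 0#
  q·1≈0 = +-identityˡ-unique (q · 1#) (sum to) (begin
    q · 1# + sum to                    ≈⟨ +-congʳ (sum-replicate q) ⟨
    sum {q} (λ _ → 1#) + sum to        ≈⟨ ∑-distrib-+ {q} (λ _ → 1#) to ⟨
    sum (λ i → 1# + to i)              ≈⟨ sum-reindex +-commutativeMonoid card (1# +_) (- 1# +_) id +-congˡ +-congˡ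
                                            (\\-leftDividesˡ 1#) (\\-leftDividesʳ 1#) ⟨
    sum to                             ∎)

  -- Multiplication by x permutes the field; u replaces 0 by 1 so that the product over the whole field can be cancelled.
  fermat : ∀ {x} → ¬ x ≈ 0# → x ^ (1 ℕ.+ r) ≈ 1#
  fermat {x} x≉0 with x⁻¹ , xx⁻¹≈1 ← inverse x x≉0 = *-cancelˡ-≉0 P≉0 (begin
    P * x ^ (1 ℕ.+ r)            ≈⟨ *-comm P _ ⟩
    x ^ (1 ℕ.+ r) * P            ≈⟨ *-congʳ ∏w ⟨
    ∏ (w ∘ to) * P               ≈⟨ ∏-distrib {q} (w ∘ to) (u ∘ to) ⟨
    ∏ (λ i → w (to i) * u (to i)) ≈⟨ ∏-cong {q} (λ i → wu≈u[x*] (to i)) ⟩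
    ∏ (u ∘ (x *_) ∘ to)          ≈⟨ sum-reindex *-commutativeMonoid card {u} (x *_) (x⁻¹ *_) u-cong *-congˡ *-congˡ
                                      (λ y → x*[x⁻¹*y]≈y xx⁻¹≈1 y) (λ y → x*[x⁻¹*y]≈y (trans (*-comm _ _) xx⁻¹≈1) y) ⟨
    P                            ≈⟨ *-identityʳ P ⟨
    P * 1#                       ∎)
    where
    open MonoidSum *-commutativeMonoid using ()
      renaming (sum to ∏; sum-remove to ∏-remove; sum-cong-≋ to ∏-cong; sum-replicate to ∏-replicate; ∑-distrib-+ to ∏-distrib)
    u w : Carrier → Carrier
    u y = case y ≟ 0# of λ { (yes _) → 1# ; (no _) → y }
    -- `w` is the factor by which `u` changes when its argument is multiplied by x: it is x at the q
    -- - 1 nonzero elements and 1 at zero.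
    w y = case y ≟ 0# of λ { (yes _) → 1# ; (no _) → x }
    P = ∏ (u ∘ to)

    u≉0 : ∀ y → ¬ u y ≈ 0#
    u≉0 y with y ≟ 0#
    ... | yes _  = 0≉1 ∘ sym
    ... | no y≉0 = y≉0

    ∏≉0 : ∀ n (v : Fin n → Carrier) → (∀ i → ¬ v i ≈ 0#) → ¬ ∏ v ≈ 0#
    ∏≉0 zero    v v≉0 1≈0 = 0≉1 (sym 1≈0)
    ∏≉0 (suc n) v v≉0 ≈0  = ∏≉0 n (v ∘ suc) (v≉0 ∘ suc) (xy≈0⇒y≈0 (v≉0 zero) ≈0)

    P≉0 : ¬ P ≈ 0#
    P≉0 = ∏≉0 q (u ∘ to) (u≉0 ∘ to)

    u-cong : ∀ {y z} → y ≈ z → u y ≈ u z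
    u-cong {y} {z} y≈z with y ≟ 0# | z ≟ 0#
    ... | yes _   | yes _   = refl
    ... | no _    | no _    = y≈z
    ... | yes y≈0 | no z≉0  = contradiction (trans (sym y≈z) y≈0) z≉0
    ... | no y≉0  | yes z≈0 = contradiction (trans y≈z z≈0) y≉0

    wu≈u[x*] : ∀ y → w y * u y ≈ u (x * y)
    wu≈u[x*] y with y ≟ 0# | x * y ≟ 0#
    ... | yes _   | yes _    = *-identityˡ 1#
    ... | no _    | no _     = refl
    ... | yes y≈0 | no xy≉0  = contradiction (trans (*-congˡ y≈0) (zeroʳ x)) xy≉0
    ... | no y≉0  | yes xy≈0 = contradiction (xy≈0⇒y≈0 x≉0 xy≈0) y≉0

    x*[x⁻¹*y]≈y : ∀ {a b} → a * b ≈ 1# → ∀ y → a * (b * y) ≈ y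
    x*[x⁻¹*y]≈y ab≈1 y = trans (sym (*-assoc _ _ y)) (trans (*-congʳ ab≈1) (*-identityˡ y))

    i₀ = from 0#
    to-i₀≈0 = strictlyInverseˡ 0#

    w[i₀] : w (to i₀) ≈ 1#
    w[i₀] with to i₀ ≟ 0#
    ... | yes _ = refl
    ... | no ≉0 = contradiction to-i₀≈0 ≉0

    w[i≢i₀] : ∀ j → w (to (punchIn i₀ j)) ≈ x
    w[i≢i₀] j with to (punchIn i₀ j) ≟ 0#
    ... | yes ≈0 = contradiction (to-injective (trans ≈0 (sym to-i₀≈0))) (Fin.punchInᵢ≢i i₀ j)
    ... | no _   = refl

    ∏w : ∏ (w ∘ to) ≈ x ^ (1 ℕ.+ r)
    ∏w = begin
      ∏ (w ∘ to)                                   ≈⟨ ∏-remove {i = i₀} (w ∘ to) ⟩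
      w (to i₀) * ∏ (removeAt (w ∘ to) i₀)         ≈⟨ *-cong w[i₀] (∏-cong {1 ℕ.+ r} w[i≢i₀]) ⟩
      1# * ∏ {1 ℕ.+ r} (λ _ → x)                   ≈⟨ *-identityˡ _ ⟩
      ∏ {1 ℕ.+ r} (λ _ → x)                        ≈⟨ ∏-replicate (1 ℕ.+ r) ⟩
      x ^ (1 ℕ.+ r)                                ∎

  x^q≈x : ∀ x → x ^ q ≈ x
  x^q≈x x with x ≟ 0#
  ... | yes x≈0 = trans (*-congʳ x≈0) (trans (zeroˡ _) (sym x≈0))
  ... | no  x≉0 = trans (*-congˡ (fermat x≉0)) (*-identityʳ x)

  -- Comparison of coefficients and reduction modulo x^q - x.

  evalSeq≈0⇒≈0 : ∀ {n} c → n ℕ.≤ q → (∀ x → evalSeq n c x ≈ 0#) → ∀ i → i ℕ.< n → c i ≈ 0#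
  evalSeq≈0⇒≈0 {n} c n≤q vanishes i i<n = applyUpTo⁻ c n
    (vanishing⇒≈0 q to to-injective (applyUpTo c n) (subst (ℕ._≤ q) (≡.sym (List.length-applyUpTo c n)) n≤q)
      (λ j → trans (eval-applyUpTo n c (to j)) (vanishes (to j))))
    i<n

  -- The difference has q coefficients and vanishes at all q elements.
  evalSeq-injective : ∀ c e → (∀ x → evalSeq q c x ≈ evalSeq q e x) → ∀ i → i ℕ.< q → c i ≈ e i
  evalSeq-injective c e c≈e i i<q = x∙y⁻¹≈ε⇒x≈y (c i) (e i) (evalSeq≈0⇒≈0 (λ i → c i - e i) ℕ.≤-refl vanishes i i<q)
    where
    vanishes : ∀ x → evalSeq q (λ i → c i - e i) x ≈ 0#
    vanishes x = +-identityˡ-unique _ (evalSeq q e x) (begin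
      evalSeq q (λ i → c i - e i) x + evalSeq q e x  ≈⟨ evalSeq-distrib-+ q (λ i → c i - e i) e x ⟨
      evalSeq q (λ i → c i - e i + e i) x            ≈⟨ ∑<-cong q (λ i _ → *-congʳ {x ^ i} (//-rightDividesˡ (e i) (c i))) ⟩
      evalSeq q c x                                  ≈⟨ c≈e x ⟩
      evalSeq q e x                                  ∎)

  -- Multiplication by x modulo x^q − x.
  shift : (ℕ → Carrier) → ℕ → Carrier
  shift c 0             = 0#
  -- The top term becomes x^q = x, so its coefficient reappears at exponent 1 and not at 0.
  shift c 1             = c 0 + c (1 ℕ.+ r)
  shift c (suc (suc i)) = c (suc i)

  evalSeq-shift : ∀ c x → evalSeq q (shift c) x ≈ x * evalSeq q c x
  evalSeq-shift c x = begin
    evalSeq q (shift c) x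
      ≈⟨ trans (evalSeq-suc (1 ℕ.+ r) (shift c) x) (+-identityˡ _) ⟩
    x * evalSeq (1 ℕ.+ r) (shift c ∘ suc) x
      ≈⟨ *-congˡ (evalSeq-suc r (shift c ∘ suc) x) ⟩
    x * ((c 0 + cᵣ) + x * E)
      ≈⟨ solve 4 (λ x c₀ cᵣ E → x :* ((c₀ :+ cᵣ) :+ x :* E) := x :* (c₀ :+ x :* E) :+ cᵣ :* x) refl x (c 0) cᵣ E ⟩
    x * (c 0 + x * E) + cᵣ * x
      ≈⟨ +-cong (*-congˡ (evalSeq-suc r c x)) (*-congˡ (x^q≈x x)) ⟨
    x * evalSeq (1 ℕ.+ r) c x + cᵣ * (x * x ^ (1 ℕ.+ r))
      ≈⟨ solve 4 (λ x S cᵣ y → x :* S :+ cᵣ :* (x :* y) := x :* (S :+ cᵣ :* y)) refl x (evalSeq (1 ℕ.+ r) c x) cᵣ (x ^ (1 ℕ.+ r)) ⟩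
    x * (evalSeq (1 ℕ.+ r) c x + cᵣ * x ^ (1 ℕ.+ r))
      ≈⟨ *-congˡ (∑<-suc (1 ℕ.+ r) (λ i → c i * x ^ i)) ⟨
    x * evalSeq q c x ∎
    where
    cᵣ = c (1 ℕ.+ r)
    E  = evalSeq r (c ∘ suc) x

  -- A property of functions and not of coefficient lists, since it is also needed for y ↦ f(y^t).
  Reducible : (Carrier → Carrier) → Set _
  Reducible g = ∃[ c ] (∀ x → g x ≈ evalSeq q c x)

  reducible-x^n* : ∀ n {g} → Reducible g → Reducible (λ x → x ^ n * g x)
  reducible-x^n* zero    (c , g≈c) = c , λ x → trans (*-identityˡ _) (g≈c x)
  reducible-x^n* (suc n) red with c , eq ← reducible-x^n* n red =
    shift c , λ x → trans (*-assoc _ _ _) (trans (*-congˡ (eq x)) (sym (evalSeq-shift c x)))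

  reducible-const+ : ∀ a {g} → Reducible g → Reducible (λ x → a + g x)
  reducible-const+ a (c , g≈c) = c′ , λ x → begin
    a + _                                              ≈⟨ +-congˡ (trans (g≈c x) (evalSeq-suc (1 ℕ.+ r) c x)) ⟩
    a + (c 0 + x * evalSeq (1 ℕ.+ r) (c ∘ suc) x)      ≈⟨ +-assoc _ _ _ ⟨
    a + c 0 + x * evalSeq (1 ℕ.+ r) (c ∘ suc) x        ≈⟨ evalSeq-suc (1 ℕ.+ r) c′ x ⟨
    evalSeq q c′ x                                     ∎
    where
    c′ : ℕ → Carrier
    c′ zero    = a + c 0
    c′ (suc i) = c (suc i)

  -- Horner's rule in the variable x^n. The case n = 1 reduces f itself, the case n = t reduces L.
  reducible-eval∘^ : ∀ f n → Reducible (λ x → eval F f (x ^ n))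
  reducible-eval∘^ []       n = (λ _ → 0#) , λ x → sym (∑<-zero q (λ i _ → zeroˡ (x ^ i)))
  reducible-eval∘^ (a ∷ as) n = reducible-const+ a (reducible-x^n* n (reducible-eval∘^ as n))

  -- Shared by both comparisons of coefficients: for f with d and a from the Costas condition, and
  -- for L with the multipliers d + 1 and d.
  reducible-scale-additive : ∀ {g} ((c , _) : Reducible g) → ∀ {d a} → (∀ x → g (d * x) ≈ g x + g (a * x)) →
    ∀ i → i ℕ.< q → ¬ c i ≈ 0# → d ^ i ≈ 1# + a ^ i
  reducible-scale-additive {g} (c , g≈c) {d} {a} eq i i<q cᵢ≉0 = *-cancelˡ-≉0 cᵢ≉0 (begin
    c i * d ^ i             ≈⟨ evalSeq-injective (λ i → c i * d ^ i) (λ i → c i + c i * a ^ i) same i i<q ⟩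
    c i + c i * a ^ i       ≈⟨ +-congʳ (*-identityʳ (c i)) ⟨
    c i * 1# + c i * a ^ i  ≈⟨ distribˡ _ _ _ ⟨
    c i * (1# + a ^ i)      ∎)
    where
    same : ∀ x → evalSeq q (λ i → c i * d ^ i) x ≈ evalSeq q (λ i → c i + c i * a ^ i) x
    same x = begin
      evalSeq q (λ i → c i * d ^ i) x                       ≈⟨ evalSeq-scale q c d x ⟩
      evalSeq q c (d * x)                                   ≈⟨ g≈c (d * x) ⟨
      g (d * x)                                             ≈⟨ eq x ⟩
      g x + g (a * x)                                       ≈⟨ +-cong (g≈c x) (g≈c (a * x)) ⟩
      evalSeq q c x + evalSeq q c (a * x)                   ≈⟨ +-congˡ (evalSeq-scale q c a x) ⟨
      evalSeq q c x + evalSeq q (λ i → c i * a ^ i) x       ≈⟨ evalSeq-distrib-+ q c (λ i → c i * a ^ i) x ⟨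
      evalSeq q (λ i → c i + c i * a ^ i) x                 ∎

  -- If every x satisfies x^(1+k) = x with 1 + k < q, then the nonzero polynomial x^(1+k) − x has q roots.
  fermat-optimal : ∀ {k} → 0 ℕ.< k → k ℕ.≤ r → ¬ (∀ x → ¬ x ≈ 0# → x ^ k ≈ 1#)
  fermat-optimal {suc k} _ k<r x^k≈1 with vanishing⇒≈0 q to to-injective f len (λ i → root (to i))
    where
    monomial : ℕ → List Carrier
    monomial k = replicate k 0# ++ 1# ∷ []
    -- The extra factor x makes zero a root too, so the enumeration of the whole field can serve as
    -- the list of roots.
    f = 0# ∷ - 1# ∷ monomial k
    eval-monomial : ∀ k x → eval F (monomial k) x ≈ x ^ k
    eval-monomial zero    x = trans (+-congˡ (zeroʳ x)) (+-identityʳ 1#)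
    eval-monomial (suc k) x = trans (+-identityˡ _) (*-congˡ (eval-monomial k x))
    length-monomial : ∀ k → length (monomial k) ≡ suc k
    length-monomial k = ≡.trans (List.length-++ (replicate k 0#)) (≡.trans (cong (ℕ._+ 1) (List.length-replicate k)) (ℕ.+-comm k 1))
    len : length f ℕ.≤ q
    len = subst (λ l → 2 ℕ.+ l ℕ.≤ q) (≡.sym (length-monomial k)) (ℕ.+-monoʳ-≤ 2 k<r)
    root : ∀ x → eval F f x ≈ 0#
    root x = trans (+-identityˡ _) (case x ≟ 0# of λ where
      (yes x≈0) → trans (*-congʳ x≈0) (zeroˡ _)
      (no  x≉0) → trans (*-congˡ (trans (+-congˡ (trans (*-congˡ (eval-monomial k x)) (x^k≈1 x x≉0))) (-‿inverseˡ 1#))) (zeroʳ x))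
  ... | _ ∷ -1≈0 ∷ _ = 0≉1 (sym (-‿injective (trans -1≈0 (sym -0#≈0#))))

  -- Bézout makes su congruent to 1 or -1 modulo q - 1, and by Fermat only this residue matters for
  -- nonzero x. Zero is treated apart and needs positive exponents.
  inverse-exponent : ∀ {s} → 0 ℕ.< s → gcd s (1 ℕ.+ r) ≡ 1 → ∃[ t ] (0 ℕ.< t × (∀ x → (x ^ s) ^ t ≈ x))
  inverse-exponent {s} 0<s coprime with coprime-Bézout (gcd≡1⇒coprime coprime)
  ... | Bézout.+- zero    v ()
  ... | Bézout.+- u@(suc _) v 1+v[q-1]≡us = u , s≤s z≤n , [x^s]^u≈x
    where
    [x^s]^u≈x : ∀ x → (x ^ s) ^ u ≈ x
    [x^s]^u≈x x with x ≟ 0#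
    ... | yes x≈0 = trans (*-congʳ (trans (^-congˡ s x≈0) (0^n≈0 0<s))) (trans (zeroˡ _) (sym x≈0))
    ... | no  x≉0 = begin
      (x ^ s) ^ u                     ≈⟨ ^-assocʳ x s u ⟩
      x ^ (s ℕ.* u)                   ≡⟨ cong (x ^_) (≡.trans (ℕ.*-comm s u) (≡.sym 1+v[q-1]≡us)) ⟩
      x * x ^ (v ℕ.* (1 ℕ.+ r))       ≡⟨ cong (λ k → x * x ^ k) (ℕ.*-comm v (1 ℕ.+ r)) ⟩
      x * x ^ ((1 ℕ.+ r) ℕ.* v)       ≈⟨ *-congˡ (^-assocʳ x (1 ℕ.+ r) v) ⟨
      x * (x ^ (1 ℕ.+ r)) ^ v         ≈⟨ *-congˡ (trans (^-congˡ v (fermat x≉0)) (1^n≈1 v)) ⟩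
      x * 1#                          ≈⟨ *-identityʳ x ⟩
      x                               ∎
  -- Here x^(su) = x⁻¹, so raising to the power su twice is the identity; q − 1 is added to keep the exponent positive.
  inverse-exponent {s} 0<s coprime | Bézout.-+ u v 1+us≡v[q-1] = t , ℕ.m≤n⇒m≤o+n (u ℕ.* (s ℕ.* u)) (s≤s z≤n) , [x^s]^t≈x
    where
    t = u ℕ.* (s ℕ.* u) ℕ.+ (1 ℕ.+ r)
    x*x^[su]≈1 : ∀ {x} → ¬ x ≈ 0# → x * x ^ (s ℕ.* u) ≈ 1#
    x*x^[su]≈1 {x} x≉0 = begin
      x ^ (1 ℕ.+ s ℕ.* u)             ≡⟨ cong (x ^_) (≡.trans (cong suc (ℕ.*-comm s u)) (≡.trans 1+us≡v[q-1] (ℕ.*-comm v _))) ⟩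
      x ^ ((1 ℕ.+ r) ℕ.* v)           ≈⟨ ^-assocʳ x (1 ℕ.+ r) v ⟨
      (x ^ (1 ℕ.+ r)) ^ v             ≈⟨ trans (^-congˡ v (fermat x≉0)) (1^n≈1 v) ⟩
      1#                              ∎
    [x^s]^t≈x : ∀ x → (x ^ s) ^ t ≈ x
    [x^s]^t≈x x with x ≟ 0#
    ... | yes x≈0 = trans (^-congˡ t (trans (^-congˡ s x≈0) (0^n≈0 0<s)))
                      (trans (0^n≈0 (ℕ.m≤n⇒m≤o+n (u ℕ.* (s ℕ.* u)) (s≤s z≤n))) (sym x≈0))
    ... | no  x≉0 = begin
      (x ^ s) ^ t                                         ≈⟨ ^-homo-* (x ^ s) (u ℕ.* (s ℕ.* u)) (1 ℕ.+ r) ⟩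
      (x ^ s) ^ (u ℕ.* (s ℕ.* u)) * (x ^ s) ^ (1 ℕ.+ r)   ≈⟨ *-cong (sym (^-assocʳ (x ^ s) u (s ℕ.* u))) (fermat (^≉0 x≉0 s)) ⟩
      ((x ^ s) ^ u) ^ (s ℕ.* u) * 1#                      ≈⟨ *-identityʳ _ ⟩
      ((x ^ s) ^ u) ^ (s ℕ.* u)                           ≈⟨ ^-congˡ (s ℕ.* u) (^-assocʳ x s u) ⟩
      y ^ (s ℕ.* u)                                       ≈⟨ *-identityˡ _ ⟨
      1# * y ^ (s ℕ.* u)                                  ≈⟨ *-congʳ (x*x^[su]≈1 x≉0) ⟨
      x * y * y ^ (s ℕ.* u)                               ≈⟨ *-assoc x y _ ⟩
      x * (y * y ^ (s ℕ.* u))                             ≈⟨ *-congˡ (x*x^[su]≈1 (^≉0 x≉0 (s ℕ.* u))) ⟩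
      x * 1#                                              ≈⟨ *-identityʳ x ⟩
      x                                                   ∎
      where y = x ^ (s ℕ.* u)

-- Characteristic p and linearized polynomials.

module CostasPolynomials {c ℓ} (F : Field c ℓ) {p m r : ℕ} (pr : Prime p) (p^m≡q : p ℕ.^ m ≡ 2 ℕ.+ r)
  (card : HasCard F (2 ℕ.+ r)) where
  open Field F hiding (zero; inverse)
  open FieldProperties F
  open FiniteField F r card
  open SetoidReasoning setoid

  private
    instance _ = prime⇒nonZero pr

  1<p : 1 ℕ.< p
  1<p = ℕ.nonTrivial⇒n>1 p {{prime⇒nonTrivial pr}}

  -- (p·1)^m = p^m·1 = q·1 = 0, and no power of a nonzero field element vanishes.
  p·1≈0 : p · 1# ≈ 0#
  p·1≈0 = decidable-stable (p · 1# ≟ 0#) λ p·1≉0 → ^≉0 p·1≉0 m (begin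
    (p · 1#) ^ m      ≈⟨ power m ⟨
    (p ℕ.^ m) · 1#    ≡⟨ cong (_· 1#) p^m≡q ⟩
    q · 1#            ≈⟨ q·1≈0 ⟩
    0#                ∎)
    where
    power : ∀ k → (p ℕ.^ k) · 1# ≈ (p · 1#) ^ k
    power zero    = ×-homo-1 1#
    power (suc k) = trans (×1-homo-* p (p ℕ.^ k)) (*-congˡ (power k))

  open Frobenius pr p·1≈0

  -- Additivity gives (x - y)^p = x^p - y^p = 0. This permits taking p-th roots of an identity
  -- between powers.
  frobenius-injective : ∀ {x y} → x ^ p ≈ y ^ p → x ≈ y
  frobenius-injective {x} {y} x^p≈y^p = x∙y⁻¹≈ε⇒x≈y x y (decidable-stable (x - y ≟ 0#) λ x-y≉0 →
    ^≉0 x-y≉0 p (+-identityˡ-unique _ (y ^ p) (begin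
      (x - y) ^ p + y ^ p   ≈⟨ frobenius-additive (x - y) y ⟨
      (x - y + y) ^ p       ≈⟨ ^-congˡ p (//-rightDividesˡ y x) ⟩
      x ^ p                 ≈⟨ x^p≈y^p ⟩
      y ^ p                 ∎)))

  linEval-additive : ∀ cs → Additive (linEval F p m cs)
  linEval-additive cs x y = begin
    linEval F p m cs (x + y)
      ≈⟨ linEval≈ p m cs (x + y) ⟩
    ∑[ j < m ] (cs j * (x + y) ^ (p ℕ.^ toℕ j))
      ≈⟨ sum-cong-≋ {m} (λ j → trans (*-congˡ (frobenius^-additive (toℕ j) x y)) (distribˡ (cs j) _ _)) ⟩
    ∑[ j < m ] (cs j * x ^ (p ℕ.^ toℕ j) + cs j * y ^ (p ℕ.^ toℕ j))
      ≈⟨ ∑-distrib-+ {m} (λ j → cs j * x ^ (p ℕ.^ toℕ j)) (λ j → cs j * y ^ (p ℕ.^ toℕ j)) ⟩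
    ∑[ j < m ] (cs j * x ^ (p ℕ.^ toℕ j)) + ∑[ j < m ] (cs j * y ^ (p ℕ.^ toℕ j))
      ≈⟨ +-cong (linEval≈ p m cs x) (linEval≈ p m cs y) ⟨
    linEval F p m cs x + linEval F p m cs y ∎

  -- A factor p of the exponent is removed by injectivity of Frobenius. An exponent n ≥ 2 prime to p is impossible,
  -- because (d + 1)ⁿ − dⁿ − 1 has degree less than q and the coefficient n ≠ 0 at d.
  additive-exponent : ∀ n → 0 ℕ.< n → n ℕ.< q → (∀ d → (d + 1#) ^ n ≈ d ^ n + 1#) → ∃[ k ] n ≡ p ℕ.^ k
  additive-exponent = <-rec _ step
    where
    not-additive : ∀ n → ¬ p ∣ n → 1 ℕ.< n → n ℕ.≤ q → ¬ (∀ d → (d + 1#) ^ n ≈ d ^ n + 1#)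
    not-additive (suc zero)      p∤n (s≤s ()) n≤q additive
    not-additive n@(suc (suc k)) p∤n _ n≤q additive = coprime⇒·1≉0 (prime∤⇒coprime pr p∤n) p·1≈0 (begin
      n · 1#         ≡⟨ cong (_· 1#) (nC1≡n n) ⟨
      (n C 1) · 1#   ≈⟨ evalSeq≈0⇒≈0 coeff n≤q vanishes 1 (s≤s (s≤s z≤n)) ⟩
      0#             ∎)
      where
      -- Coefficients of (d + 1)^n - d^n - 1 at the exponents below n: the constant terms cancel,
      -- and the one at exponent 1 is n.
      coeff : ℕ → Carrier
      coeff zero    = 0#
      coeff (suc j) = (n C suc j) · 1#
      middle : Carrier → Carrier
      middle d = ∑< (1 ℕ.+ k) (λ j → (n C (1 ℕ.+ j)) · (d ^ (1 ℕ.+ j) * 1# ^ (1 ℕ.+ k ℕ.∸ j)))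
      middle≈0 : ∀ d → middle d ≈ 0#
      middle≈0 d = +-identityˡ-unique (middle d) (d ^ n) (+-cancelˡ 1# _ _ (begin
        1# + (middle d + d ^ n)       ≈⟨ +-congʳ (1^n≈1 n) ⟨
        1# ^ n + (middle d + d ^ n)   ≈⟨ binomial-middle k d 1# ⟨
        (d + 1#) ^ n                  ≈⟨ additive d ⟩
        d ^ n + 1#                    ≈⟨ +-comm _ _ ⟩
        1# + d ^ n                    ∎))
      vanishes : ∀ d → evalSeq n coeff d ≈ 0#
      vanishes d = begin
        evalSeq n coeff d     ≈⟨ trans (+-congʳ (zeroˡ _)) (+-identityˡ _) ⟩
        ∑< (1 ℕ.+ k) (λ j → (n C (1 ℕ.+ j)) · 1# * d ^ (1 ℕ.+ j))
                              ≈⟨ ∑<-cong (1 ℕ.+ k) (λ j _ → trans (×-assoc-* (n C (1 ℕ.+ j)) 1# (d ^ (1 ℕ.+ j))) (×-congʳ (n C (1 ℕ.+ j))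
                                   (trans (*-comm 1# _) (*-congˡ (sym (1^n≈1 (1 ℕ.+ k ℕ.∸ j))))))) ⟩
        middle d              ≈⟨ middle≈0 d ⟩
        0#                    ∎

    step : ∀ n → (∀ {i} → i ℕ.< n → 0 ℕ.< i → i ℕ.< q → (∀ d → (d + 1#) ^ i ≈ d ^ i + 1#) → ∃[ k ] i ≡ p ℕ.^ k) →
      0 ℕ.< n → n ℕ.< q → (∀ d → (d + 1#) ^ n ≈ d ^ n + 1#) → ∃[ k ] n ≡ p ℕ.^ k
    step n rec 0<n n<q additive with p ∣? n
    ... | no p∤n with ℕ.m≤n⇒m<n∨m≡n 0<n
    ...   | inj₁ 1<n = contradiction additive (not-additive n p∤n 1<n (ℕ.<⇒≤ n<q))
    ...   | inj₂ 1≡n = 0 , ≡.sym 1≡n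
    step n rec 0<n n<q additive | yes (divides zero    n≡0)  = contradiction n≡0 (ℕ.n>0⇒n≢0 0<n)
    step n rec 0<n n<q additive | yes (divides i@(suc _) n≡ip) =
      let k , i≡p^k = rec i<n (s≤s z≤n) (ℕ.<-trans i<n n<q) additive′
      in  suc k , ≡.trans n≡pi (cong (p ℕ.*_) i≡p^k)
      where
      n≡pi = ≡.trans n≡ip (ℕ.*-comm i p)
      i<n : i ℕ.< n
      i<n = subst (i ℕ.<_) (≡.sym n≡ip) (ℕ.m<m*n i p 1<p)
      [x^i]^p≈x^n : ∀ x → (x ^ i) ^ p ≈ x ^ n
      [x^i]^p≈x^n x = trans (^-assocʳ x i p) (^-congʳ x (≡.sym n≡ip))
      additive′ : ∀ d → (d + 1#) ^ i ≈ d ^ i + 1#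
      additive′ d = frobenius-injective (begin
        ((d + 1#) ^ i) ^ p        ≈⟨ [x^i]^p≈x^n (d + 1#) ⟩
        (d + 1#) ^ n              ≈⟨ additive d ⟩
        d ^ n + 1#                ≈⟨ +-cong ([x^i]^p≈x^n d) (1^n≈1 p) ⟨
        (d ^ i) ^ p + 1# ^ p      ≈⟨ frobenius-additive (d ^ i) 1# ⟨
        (d ^ i + 1#) ^ p          ∎)

  -- Among the indices from p^k up to but excluding p^(1+k) only the first is a power of p, so each
  -- such block contributes one term. The initial block is the index 0 alone.
  ∑<-powers : ∀ k g → g 0 ≈ 0# → (∀ i → i ℕ.< p ℕ.^ k → ¬ g i ≈ 0# → ∃[ j ] i ≡ p ℕ.^ j) →
    ∑< (p ℕ.^ k) g ≈ ∑< k (g ∘ (p ℕ.^_))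
  ∑<-powers zero    g g₀≈0 support = trans (+-identityʳ _) g₀≈0
  ∑<-powers (suc k) g g₀≈0 support with o , 1+p^k+o≡p^[1+k] ← ℕ.m≤n⇒∃[o]m+o≡n (ℕ.^-monoʳ-< p 1<p (ℕ.n<1+n k)) = begin
    ∑< (p ℕ.^ suc k) g
      ≡⟨ cong (λ N → ∑< N g) eq ⟨
    ∑< (p ℕ.^ k ℕ.+ suc o) g
      ≈⟨ ∑<-+ (p ℕ.^ k) (suc o) g ⟩
    ∑< (p ℕ.^ k) g + (g (p ℕ.^ k ℕ.+ 0) + ∑< o (λ i → g (p ℕ.^ k ℕ.+ suc i)))
      ≈⟨ +-cong (∑<-powers k g g₀≈0 (λ i i<p^k → support i (ℕ.<-trans i<p^k p^k<p^[1+k])))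
                (+-cong (reflexive (cong g (ℕ.+-identityʳ (p ℕ.^ k)))) (∑<-zero o gap)) ⟩
    ∑< k (g ∘ (p ℕ.^_)) + (g (p ℕ.^ k) + 0#)
      ≈⟨ +-congˡ (+-identityʳ _) ⟩
    ∑< k (g ∘ (p ℕ.^_)) + g (p ℕ.^ k)
      ≈⟨ ∑<-suc k (g ∘ (p ℕ.^_)) ⟨
    ∑< (suc k) (g ∘ (p ℕ.^_)) ∎
    where
    p^k<p^[1+k] = ℕ.^-monoʳ-< p 1<p (ℕ.n<1+n k)
    eq : p ℕ.^ k ℕ.+ suc o ≡ p ℕ.^ suc k
    eq = ≡.trans (ℕ.+-suc (p ℕ.^ k) o) 1+p^k+o≡p^[1+k]
    gap : ∀ i → i ℕ.< o → g (p ℕ.^ k ℕ.+ suc i) ≈ 0#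
    gap i i<o = decidable-stable (g n ≟ 0#) λ gₙ≉0 → not-power (support n n<p^[1+k] gₙ≉0)
      where
      n = p ℕ.^ k ℕ.+ suc i
      n<p^[1+k] : n ℕ.< p ℕ.^ suc k
      n<p^[1+k] = subst (n ℕ.<_) eq (ℕ.+-monoʳ-< (p ℕ.^ k) (s≤s i<o))
      not-power : ¬ (∃[ j ] n ≡ p ℕ.^ j)
      not-power (j , n≡p^j) with ℕ.≤-<-connex j k
      ... | inj₁ j≤k = ℕ.<⇒≱ (ℕ.m<m+n (p ℕ.^ k) (s≤s z≤n)) (subst (ℕ._≤ p ℕ.^ k) (≡.sym n≡p^j) (ℕ.^-monoʳ-≤ p j≤k))
      ... | inj₂ k<j = ℕ.<⇒≱ n<p^[1+k] (subst (p ℕ.^ suc k ℕ.≤_) (≡.sym n≡p^j) (ℕ.^-monoʳ-≤ p k<j))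

  additive⇒linearized : ∀ {L} → Reducible L → Additive L → (∀ {x y} → x ≈ y → L x ≈ L y) →
    ∃[ cs ] (∀ x → linEval F p m cs x ≈ L x)
  additive⇒linearized {L} red@(e , L≈e) additive L-cong = cs , λ x → begin
    linEval F p m cs x                                ≈⟨ linEval≈ p m cs x ⟩
    ∑< m (λ j → e (p ℕ.^ j) * x ^ (p ℕ.^ j))          ≈⟨ ∑<-powers m (λ i → e i * x ^ i) (e₀x⁰≈0 x) (support x) ⟨
    evalSeq (p ℕ.^ m) e x                             ≡⟨ cong (λ n → evalSeq n e x) p^m≡q ⟩
    evalSeq q e x                                     ≈⟨ L≈e x ⟨
    L x                                               ∎
    where
    cs : Fin m → Carrier
    cs j = e (p ℕ.^ toℕ j)
    e₀≈0 : e 0 ≈ 0#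
    e₀≈0 = begin
      e 0             ≈⟨ evalSeq-0 (1 ℕ.+ r) e ⟨
      evalSeq q e 0#  ≈⟨ L≈e 0# ⟨
      L 0#            ≈⟨ +-identityˡ-unique (L 0#) (L 0#) (trans (sym (additive 0# 0#)) (L-cong (+-identityˡ 0#))) ⟩
      0#              ∎
    e₀x⁰≈0 : ∀ x → e 0 * x ^ 0 ≈ 0#
    e₀x⁰≈0 x = trans (*-identityʳ _) e₀≈0
    -- This has the shape of the Costas relation, with d + 1 in place of d and d in place of a, so
    -- coefficients can be compared as they were for f.
    L-scale : ∀ d x → L ((d + 1#) * x) ≈ L x + L (d * x)
    L-scale d x = begin
      L ((d + 1#) * x)    ≈⟨ L-cong (trans (distribʳ x d 1#) (trans (+-comm _ _) (+-congʳ (*-identityˡ x)))) ⟩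
      L (x + d * x)       ≈⟨ additive x (d * x) ⟩
      L x + L (d * x)     ∎
    support : ∀ x i → i ℕ.< p ℕ.^ m → ¬ e i * x ^ i ≈ 0# → ∃[ k ] i ≡ p ℕ.^ k
    support x zero      i<p^m eᵢxⁱ≉0 = contradiction (e₀x⁰≈0 x) eᵢxⁱ≉0
    support x i@(suc _) i<p^m eᵢxⁱ≉0 = additive-exponent i (s≤s z≤n) i<q λ d → trans
      (reducible-scale-additive red (L-scale d) i i<q λ eᵢ≈0 → eᵢxⁱ≉0 (trans (*-congʳ eᵢ≈0) (zeroˡ _)))
      (+-comm _ _)
      where i<q = subst (i ℕ.<_) p^m≡q i<p^m

  -- Linearized powers are shifting Costas polynomials.

  IsLinearizedPower : Poly F → Set _
  IsLinearizedPower f = ∃[ cs ] ∃[ s ] (IsPermutation F (linEval F p m cs) × 0 ℕ.< s × gcd s (1 ℕ.+ r) ≡ 1 ×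
    (∀ x → eval F f x ≈ linEval F p m cs (pow F x s)))

  linearizedPower⇒shiftingCostas : ∀ f → IsLinearizedPower f → IsShiftingCostas F f
  linearizedPower⇒shiftingCostas f (cs , s , (L-injective , L-surjective) , 0<s , gcd≡1 , f≈L∘pow)
    with t , 0<t , [x^s]^t≈x ← inverse-exponent 0<s gcd≡1 = (f-injective , f-surjective) , costas
    where
    L = linEval F p m cs
    L-cong = linEval-cong p m cs

    f≈L : ∀ x → eval F f x ≈ L (x ^ s)
    f≈L x = trans (f≈L∘pow x) (reflexive (cong L (pow≡^ x s)))

    [x^t]^s≈x : ∀ x → (x ^ t) ^ s ≈ x
    [x^t]^s≈x x = trans (^-^-comm x t s) ([x^s]^t≈x x)

    ^s-injective : ∀ {x y} → x ^ s ≈ y ^ s → x ≈ y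
    ^s-injective {x} {y} eq = trans (sym ([x^s]^t≈x x)) (trans (^-congˡ t eq) ([x^s]^t≈x y))

    f-injective : ∀ x y → eval F f x ≈ eval F f y → x ≈ y
    f-injective x y fx≈fy = ^s-injective (L-injective (x ^ s) (y ^ s) (trans (sym (f≈L x)) (trans fx≈fy (f≈L y))))

    f-surjective : ∀ y → ∃[ x ] eval F f x ≈ y
    f-surjective y with z , Lz≈y ← L-surjective y = z ^ t , trans (f≈L (z ^ t)) (trans (L-cong ([x^t]^s≈x z)) Lz≈y)

    costas : ∀ d → ¬ d ≈ 1# → ∃[ a ] (¬ a ≈ 0# × (∀ x → eval F f (d * x) - eval F f x ≈ eval F f (a * x)))
    -- Raising to the power t extracts the s-th root of `b`, which is nonzero because the s-th power
    -- map is injective.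
    costas d d≉1 = b ^ t , ^≉0 b≉0 t , difference
      where
      b = d ^ s - 1#
      b≉0 : ¬ b ≈ 0#
      b≉0 b≈0 = d≉1 (^s-injective (trans (x∙y⁻¹≈ε⇒x≈y (d ^ s) 1# b≈0) (sym (1^n≈1 s))))
      difference : ∀ x → eval F f (d * x) - eval F f x ≈ eval F f (b ^ t * x)
      difference x = begin
        eval F f (d * x) - eval F f x               ≈⟨ +-cong f[dx] (-‿cong (f≈L x)) ⟩
        L (b * x ^ s) + L (x ^ s) - L (x ^ s)       ≈⟨ //-rightDividesʳ (L (x ^ s)) (L (b * x ^ s)) ⟩
        L (b * x ^ s)                               ≈⟨ L-cong (*-congʳ ([x^t]^s≈x b)) ⟨
        L ((b ^ t) ^ s * x ^ s)                     ≈⟨ L-cong (^-distrib-* (b ^ t) x s) ⟨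
        L ((b ^ t * x) ^ s)                         ≈⟨ f≈L (b ^ t * x) ⟨
        eval F f (b ^ t * x)                        ∎
        where
        f[dx] : eval F f (d * x) ≈ L (b * x ^ s) + L (x ^ s)
        f[dx] = begin
          eval F f (d * x)              ≈⟨ f≈L (d * x) ⟩
          L ((d * x) ^ s)               ≈⟨ L-cong (^-distrib-* d x s) ⟩
          L (d ^ s * x ^ s)             ≈⟨ L-cong (*-congʳ (//-rightDividesˡ 1# (d ^ s))) ⟨
          L ((b + 1#) * x ^ s)          ≈⟨ L-cong (trans (distribʳ (x ^ s) b 1#) (+-congˡ (*-identityˡ (x ^ s)))) ⟩
          L (b * x ^ s + x ^ s)         ≈⟨ linEval-additive cs (b * x ^ s) (x ^ s) ⟩
          L (b * x ^ s) + L (x ^ s)     ∎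

  -- Shifting Costas polynomials are linearized powers.

  module ShiftingCostas (f : Poly F) (isShiftingCostas : IsShiftingCostas F f) where
    open Field F using (inverse)

    private
      f-injective  = proj₁ (proj₁ isShiftingCostas)
      f-surjective = proj₂ (proj₁ isShiftingCostas)
      costas       = proj₂ isShiftingCostas

    f-cong : ∀ {x y} → x ≈ y → eval F f x ≈ eval F f y
    f-cong = eval-cong f

    costas-+ : ∀ {d} → ¬ d ≈ 1# → ∃[ a ] (¬ a ≈ 0# × (∀ x → eval F f (d * x) ≈ eval F f x + eval F f (a * x)))
    costas-+ {d} d≉1 with a , a≉0 , eq ← costas d d≉1 = a , a≉0 , λ x → begin
      eval F f (d * x)                                ≈⟨ //-rightDividesˡ (eval F f x) (eval F f (d * x)) ⟨
      eval F f (d * x) - eval F f x + eval F f x      ≈⟨ +-congʳ (eq x) ⟩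
      eval F f (a * x) + eval F f x                   ≈⟨ +-comm _ _ ⟩
      eval F f x + eval F f (a * x)                   ∎

    -- At x = 0 the condition reads f(0) - f(0) = f(0). The choice d = 0 is available in every
    -- field, and is the only one when q = 2.
    f[0]≈0 : eval F f 0# ≈ 0#
    f[0]≈0 with a , _ , eq ← costas 0# 0≉1 = begin
      eval F f 0#                         ≈⟨ f-cong (zeroʳ a) ⟨
      eval F f (a * 0#)                   ≈⟨ eq 0# ⟨
      eval F f (0# * 0#) - eval F f 0#    ≈⟨ +-congʳ (f-cong (zeroˡ 0#)) ⟩
      eval F f 0# - eval F f 0#           ≈⟨ -‿inverseʳ _ ⟩
      0#                                  ∎

    module Exponent {coeff} (f≈coeff : ∀ x → eval F f x ≈ evalSeq q coeff x)
      {s} (s<q : s ℕ.< q) (cₛ≉0 : ¬ coeff s ≈ 0#) where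

      -- The constant coefficient is f(0) = 0, so the chosen nonzero coefficient cannot be that one.
      0<s : 0 ℕ.< s
      0<s = ℕ.n≢0⇒n>0 λ s≡0 → cₛ≉0 (begin
        coeff s             ≡⟨ cong coeff s≡0 ⟩
        coeff 0             ≈⟨ evalSeq-0 (1 ℕ.+ r) coeff ⟨
        evalSeq q coeff 0#  ≈⟨ f≈coeff 0# ⟨
        eval F f 0#         ≈⟨ f[0]≈0 ⟩
        0#                  ∎)

      -- Both relations are kept for the same `a`: the first identifies `a` from its s-th power, the
      -- second is then applied to it.
      costas-^s : ∀ {d} → ¬ d ≈ 1# →
        ∃[ a ] (¬ a ≈ 0# × d ^ s ≈ 1# + a ^ s × (∀ x → eval F f (d * x) ≈ eval F f x + eval F f (a * x)))
      costas-^s d≉1 with a , a≉0 , eq ← costas-+ d≉1 =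
        a , a≉0 , reducible-scale-additive (coeff , f≈coeff) eq s s<q cₛ≉0 , eq

      ^s≈1⇒≈1 : ∀ {d} → d ^ s ≈ 1# → d ≈ 1#
      ^s≈1⇒≈1 {d} d^s≈1 = decidable-stable (d ≟ 1#) λ d≉1 →
        let a , a≉0 , d^s≈1+a^s , _ = costas-^s d≉1
        in  ^≉0 a≉0 s (+-identityʳ-unique 1# (a ^ s) (trans (sym d^s≈1+a^s) d^s≈1))

      -- With e = gcd (s , q − 1), every nonzero x^((q−1)/e) has s-th power 1, hence equals 1, which forces e = 1.
      gcd≡1 : gcd s (1 ℕ.+ r) ≡ 1
      gcd≡1 with gcd s (1 ℕ.+ r) | gcd[m,n]∣m s (1 ℕ.+ r) | gcd[m,n]∣n s (1 ℕ.+ r)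
      ... | e | divides s′ s≡s′e | divides k q-1≡ke = go e q-1≡ke s≡s′e
        where
        go : ∀ e → 1 ℕ.+ r ≡ k ℕ.* e → s ≡ s′ ℕ.* e → e ≡ 1
        go 0 q-1≡k0 _ = contradiction (≡.trans q-1≡k0 (ℕ.*-zeroʳ k)) λ ()
        go 1 _ _ = ≡.refl
        go e@(suc (suc _)) q-1≡ke s≡s′e = contradiction x^k≈1 (fermat-optimal 0<k k≤r)
          where
          0<k : 0 ℕ.< k
          0<k = ℕ.n≢0⇒n>0 λ k≡0 → case ≡.trans q-1≡ke (cong (ℕ._* e) k≡0) of λ ()
          -- Here e ≥ 2, so k is strictly smaller than q - 1, as `fermat-optimal` requires.
          k≤r : k ℕ.≤ r
          k≤r = ℕ.≤-pred (subst (k ℕ.<_) (≡.sym q-1≡ke) (ℕ.m<m*n k e {{ℕ.>-nonZero 0<k}} (s≤s (s≤s z≤n))))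
          ks≡[q-1]s′ : k ℕ.* s ≡ (1 ℕ.+ r) ℕ.* s′
          ks≡[q-1]s′ = ≡.trans (cong (k ℕ.*_) (≡.trans s≡s′e (ℕ.*-comm s′ e)))
            (≡.trans (≡.sym (ℕ.*-assoc k e s′)) (cong (ℕ._* s′) (≡.sym q-1≡ke)))
          x^k≈1 : ∀ x → ¬ x ≈ 0# → x ^ k ≈ 1#
          x^k≈1 x x≉0 = ^s≈1⇒≈1 (begin
            (x ^ k) ^ s               ≈⟨ ^-assocʳ x k s ⟩
            x ^ (k ℕ.* s)             ≡⟨ cong (x ^_) ks≡[q-1]s′ ⟩
            x ^ ((1 ℕ.+ r) ℕ.* s′)    ≈⟨ ^-assocʳ x (1 ℕ.+ r) s′ ⟨
            (x ^ (1 ℕ.+ r)) ^ s′      ≈⟨ ^-congˡ s′ (fermat x≉0) ⟩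
            1# ^ s′                   ≈⟨ 1^n≈1 s′ ⟩
            1#                        ∎)

      module Linearization {t} (0<t : 0 ℕ.< t) ([x^s]^t≈x : ∀ x → (x ^ s) ^ t ≈ x) where

        [x^t]^s≈x : ∀ x → (x ^ t) ^ s ≈ x
        [x^t]^s≈x x = trans (^-^-comm x t s) ([x^s]^t≈x x)

        L : Carrier → Carrier
        L y = eval F f (y ^ t)

        L-cong : ∀ {x y} → x ≈ y → L x ≈ L y
        L-cong x≈y = f-cong (^-congˡ t x≈y)

        L[0]≈0 : L 0# ≈ 0#
        L[0]≈0 = trans (f-cong (0^n≈0 0<t)) f[0]≈0

        -- For nonzero u and v the functional equation of f is used at x = u^t, with d^s = (u +
        -- v)/u. The case u = 0 forbids the division and v = 0 would give d = 1; both reduce to L(0)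
        -- = 0.
        L-additive : Additive L
        L-additive u v with u ≟ 0# | v ≟ 0#
        ... | yes u≈0 | _ = trans (L-cong (trans (+-congʳ u≈0) (+-identityˡ v)))
                              (sym (trans (+-congʳ (trans (L-cong u≈0) L[0]≈0)) (+-identityˡ (L v))))
        ... | no _ | yes v≈0 = trans (L-cong (trans (+-congˡ v≈0) (+-identityʳ u)))
                                 (sym (trans (+-congˡ (trans (L-cong v≈0) L[0]≈0)) (+-identityʳ (L u))))
        ... | no u≉0 | no v≉0 with u⁻¹ , uu⁻¹≈1 ← inverse u u≉0 = additive-at (costas-^s d≉1)
          where
          d = ((u + v) * u⁻¹) ^ t
          x/u*u≈x : ∀ x → x * u⁻¹ * u ≈ x
          x/u*u≈x x = trans (*-assoc x u⁻¹ u) (trans (*-congˡ (trans (*-comm u⁻¹ u) uu⁻¹≈1)) (*-identityʳ x))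
          d^s≈1+v/u : d ^ s ≈ 1# + v * u⁻¹
          d^s≈1+v/u = trans ([x^t]^s≈x _) (trans (distribʳ u⁻¹ u v) (+-congʳ uu⁻¹≈1))
          v/u≉0 : ¬ v * u⁻¹ ≈ 0#
          v/u≉0 v/u≈0 = v≉0 (trans (sym (x/u*u≈x v)) (trans (*-congʳ v/u≈0) (zeroˡ u)))
          d≉1 : ¬ d ≈ 1#
          d≉1 d≈1 = v/u≉0 (+-identityʳ-unique 1# _ (trans (sym d^s≈1+v/u) (trans (^-congˡ s d≈1) (1^n≈1 s))))
          additive-at : ∃[ a ] (¬ a ≈ 0# × d ^ s ≈ 1# + a ^ s × (∀ x → eval F f (d * x) ≈ eval F f x + eval F f (a * x))) →
            L (u + v) ≈ L u + L v
          additive-at (a , _ , d^s≈1+a^s , eq) = begin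
            L (u + v)                               ≈⟨ L-cong (x/u*u≈x (u + v)) ⟨
            L ((u + v) * u⁻¹ * u)                   ≈⟨ f-cong (^-distrib-* _ u t) ⟩
            eval F f (d * u ^ t)                    ≈⟨ eq (u ^ t) ⟩
            L u + eval F f (a * u ^ t)              ≈⟨ +-congˡ (f-cong (*-congʳ a≈[v/u]^t)) ⟩
            L u + eval F f ((v * u⁻¹) ^ t * u ^ t)  ≈⟨ +-congˡ (f-cong (^-distrib-* _ u t)) ⟨
            L u + L (v * u⁻¹ * u)                   ≈⟨ +-congˡ (L-cong (x/u*u≈x v)) ⟩
            L u + L v                               ∎
            where
            -- Cancelling 1 in 1 + a^s = d^s = 1 + v/u leaves a^s = v/u, and the t-th power undoes
            -- the s-th.
            a≈[v/u]^t : a ≈ (v * u⁻¹) ^ t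
            a≈[v/u]^t = trans (sym ([x^s]^t≈x a)) (^-congˡ t (+-cancelˡ 1# _ _ (trans (sym d^s≈1+a^s) d^s≈1+v/u)))

        module _ {cs} (lin≈L : ∀ x → linEval F p m cs x ≈ L x) where

          L-injective : ∀ x y → linEval F p m cs x ≈ linEval F p m cs y → x ≈ y
          L-injective x y eq = trans (sym ([x^t]^s≈x x)) (trans (^-congˡ s
            (f-injective (x ^ t) (y ^ t) (trans (sym (lin≈L x)) (trans eq (lin≈L y))))) ([x^t]^s≈x y))

          L-surjective : ∀ y → ∃[ x ] linEval F p m cs x ≈ y
          L-surjective y with x , fx≈y ← f-surjective y =
            x ^ s , trans (lin≈L (x ^ s)) (trans (f-cong ([x^s]^t≈x x)) fx≈y)

          f≈L : ∀ x → eval F f x ≈ linEval F p m cs (pow F x s)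
          f≈L x = begin
            eval F f x                      ≈⟨ f-cong ([x^s]^t≈x x) ⟨
            L (x ^ s)                       ≈⟨ lin≈L (x ^ s) ⟨
            linEval F p m cs (x ^ s)        ≡⟨ cong (linEval F p m cs) (pow≡^ x s) ⟨
            linEval F p m cs (pow F x s)    ∎

          isLinearizedPower : IsLinearizedPower f
          isLinearizedPower = cs , s , (L-injective , L-surjective) , 0<s , gcd≡1 , f≈L

    -- Otherwise f vanishes identically and takes the same value at 0 and 1, against injectivity.
    nonzero-coefficient : ∀ {coeff} → (∀ x → eval F f x ≈ evalSeq q coeff x) → ∃[ i ] (i ℕ.< q × ¬ coeff i ≈ 0#)
    nonzero-coefficient {coeff} f≈coeff with ℕ.anyUpTo? (λ i → ¬? (coeff i ≟ 0#)) q
    ... | yes found = found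
    ... | no  none  = contradiction (f-injective 0# 1# (trans (f≈0 0#) (sym (f≈0 1#)))) 0≉1
      where
      f≈0 : ∀ x → eval F f x ≈ 0#
      f≈0 x = trans (f≈coeff x) (∑<-zero q λ i i<q → trans
        (*-congʳ (decidable-stable (coeff i ≟ 0#) λ cᵢ≉0 → none (i , i<q , cᵢ≉0))) (zeroˡ (x ^ i)))

    reduced : Reducible (eval F f)
    reduced = map₂ (λ eq x → trans (f-cong (sym (*-identityʳ x))) (eq x)) (reducible-eval∘^ f 1)

  shiftingCostas⇒linearizedPower : ∀ f → IsShiftingCostas F f → IsLinearizedPower f
  shiftingCostas⇒linearizedPower f isShiftingCostas =
    let open ShiftingCostas f isShiftingCostas
        coeff , f≈coeff      = reduced
        s , s<q , cₛ≉0       = nonzero-coefficient {coeff} f≈coeff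
        open Exponent {coeff} f≈coeff {s} s<q cₛ≉0
        t , 0<t , [x^s]^t≈x  = inverse-exponent 0<s gcd≡1
        open Linearization {t} 0<t [x^s]^t≈x
        cs , lin≈L           = additive⇒linearized (reducible-eval∘^ f t) L-additive L-cong
    in  isLinearizedPower {cs} lin≈L

open import Data.Nat using (_≥_; _^_; _∸_)

theorem7p4 : ∀ {c ℓ} (F : Field c ℓ) (p m : ℕ) → Prime p → m ≥ 1 →
    HasCard F (p ^ m) →
    (f : Poly F) →
    IsShiftingCostas F f ⇔
    (∃[ cs ] ∃[ s ]
    (IsPermutation F (linEval F p m cs) × s ≥ 1 × gcd s (p ^ m ∸ 1) ≡ 1 ×
    (∀ x → Field._≈_ F (eval F f x) (linEval F p m cs (pow F x s)))))
theorem7p4 F p m pr m≥1 card f = split (p ^ m) ≡.refl card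
  where
  1<p^m : 1 ℕ.< p ^ m
  1<p^m = ℕ.^-monoʳ-< p (ℕ.nonTrivial⇒n>1 p {{prime⇒nonTrivial pr}}) m≥1
  -- The size is generalised to `n` so that it can be matched as 2 + r; the values 0 and 1
  -- contradict p^m > 1.
  split : ∀ n → p ^ m ≡ n → HasCard F n → IsShiftingCostas F f ⇔
    (∃[ cs ] ∃[ s ] (IsPermutation F (linEval F p m cs) × s ≥ 1 × gcd s (n ∸ 1) ≡ 1 ×
      (∀ x → Field._≈_ F (eval F f x) (linEval F p m cs (pow F x s)))))
  split 0             p^m≡0 _    = contradiction (subst (1 ℕ.<_) p^m≡0 1<p^m) λ ()
  split 1             p^m≡1 _    = contradiction (subst (1 ℕ.<_) p^m≡1 1<p^m) (ℕ.<-irrefl ≡.refl)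
  split (suc (suc r)) p^m≡q card = mk⇔ (shiftingCostas⇒linearizedPower f) (linearizedPower⇒shiftingCostas f)
    where open CostasPolynomials F {p} {m} pr p^m≡q card
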